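{- Let $D=(V,A)$ be a skeletal directed acyclic graph. For any $\mho,\Omega\subseteq V$ and any acyclic reorientation $E$ of $D$, the following statements are equivalent: (i) $E$ is minimal (resp. maximal) in its $\equiv_{(\mho,\Omega)}$-congruence class; (ii) $\nabla_{u,v}^E\subseteq\mho$ and $\Delta_{u,v}^E\subseteq\Omega$ for any arc $(u,v)$ of $D$ reversed (resp. unreversed) in the transitive reduction of $E$, i.e. such that $(v,u)$ (resp. $(u,v)$) is an arc of the transitive reduction of $E$; (iii) $\nabla_{u,v}^E\subseteq\mho$ and $\Delta_{u,v}^E\subseteq\Omega$ for any arc $(u,v)$ of $D$ reversed (resp. unreversed) in $E$.
   Context: All directed graphs are finite and simple. A reorientation of a directed acyclic graph $D=(V,A)$ is a directed graph with the same underlying undirected graph, encoded by the set of arcs of $D$ that it reverses. $\mathcal{AR}_D$ is the poset of acyclic reorientations of $D$ ordered by inclusion of sets of reversed arcs. The transitive reduction of a directed acyclic graph is obtained by deleting all arcs whose endpoints are connected by a directed path of length at least $2$. A directed graph is a forest if its underlying undirected graph has no cycle. $D$ is vertebrate if the transitive reduction of every induced subgraph of $D$ is a forest; filled if for any directed path $\pi$ in $D$ whose endpoints are joined by an arc of $D$, all arcs joining any two vertices of $\pi$ belong to $D$; skeletal if vertebrate and filled. When $D$ is skeletal, $\mathcal{AR}_D$ is a lattice. A congruence of a lattice is an equivalence relation compatible with meets and joins. It contracts a join irreducible $J$ (covering a unique element $J_\star$) if $J_\star\equiv J$. The transitive support of an arc $(u,v)$ of $D$ is the set of vertices appearing along directed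 paths in $D$ from $u$ to $v$. A rope of $D$ is a quadruple $(u,v,\nabla,\Delta)$ where $(u,v)\in A$ and $\nabla\sqcup\Delta$ is a partition of the transitive support of $(u,v)$ minus $\{u,v\}$. For a rope $\rho=(u,v,\nabla,\Delta)$, let $I_\vee(\rho)$ be the acyclic reorientation of $D$ where an arc $(w,w')$ of $D$ is reversed if and only if $w\in\Delta\cup\{u\}$ and $w'\in\nabla\cup\{v\}$; $\rho\mapsto I_\vee(\rho)$ is a bijection from the ropes of $D$ to the join irreducibles of $\mathcal{AR}_D$. For $\mho,\Omega\subseteq V$, the coherent congruence $\equiv_{(\mho,\Omega)}$ is the unique congruence of $\mathcal{AR}_D$ whose uncontracted join irreducibles are exactly the $I_\vee(\rho)$ for the ropes $\rho=(u,v,\nabla,\Delta)$ of $D$ with $\nabla\subseteq\mho$ and $\Delta\subseteq\Omega$. For an acyclic reorientation $E$ of $D$ and an arc $(u,v)$ of $D$, $\nabla_{u,v}^E=\{w\in V : (u,w)\in D\setminus E,\ (w,v)\in D\cap E\}$ and $\Delta_{u,v}^E=\{w\in V : (u,w)\in D\cap E,\ (w,v)\in D\setminus E\}$ (membership refers to arcs). -}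

module Defs where

open import Data.Fin.Base using (Fin)
open import Data.Fin.Subset using (Subset; _∈_; _∉_; _⊆_; _∪_; ⁅_⁆)
open import Data.List.Base using (List; _∷_; _∷ʳ_; length)
import Data.List.Membership.Propositional as List
open import Data.List.Relation.Unary.AllPairs using (AllPairs)
open import Data.List.Relation.Unary.Linked using (Linked)
open import Data.List.Relation.Unary.Unique.Propositional using (Unique)
open import Data.Nat.Base using (ℕ; _≤_)
open import Data.Product.Base using (Σ-syntax; ∃-syntax; ∃₂; _×_; _,_)
open import Data.Product using (∃!)
open import Data.Sum.Base using (_⊎_)
open import Function.Base using (id)
import Function.Bundles as Fun
open import Level using (Level; 0ℓ; _⊔_) renaming (suc to lsuc)
open import Relation.Binary.Bundles using (Poset)
import Relation.Binary.Construct.NonStrictToStrict as ToStrict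
open import Relation.Binary.Construct.Closure.Symmetric using (SymClosure)
open import Relation.Binary.Core using (Rel; _⇒_; _⇔_)
open import Relation.Binary.Definitions using (Decidable)
open import Relation.Binary.PropositionalEquality.Core using (_≢_)
open import Relation.Binary.Structures using (IsEquivalence)
open import Relation.Nullary.Negation.Core using (¬_)
open import Relation.Unary using (Pred)

------------------------------------------------------------------------
-- Directed graphs

module _ {A : Set} where

  -- The walk u, xs, v; it has length 1 + length xs.  Vertices may repeat, but
  -- in an acyclic graph every walk is a path.
  Path : Rel A 0ℓ → A → List A → A → Set
  Path R u xs v = Linked R (u ∷ xs ∷ʳ v)

  Acyclic : Rel A 0ℓ → Set
  Acyclic R = ¬ (∃₂ λ u xs → Path R u xs u)

  TransitiveReduction : Rel A 0ℓ → Rel A 0ℓ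
  TransitiveReduction R u v = R u v × ¬ (∃₂ λ w xs → Path R u (w ∷ xs) v)

  -- The underlying undirected graph has no cycle u, xs, u (at least three
  -- pairwise distinct vertices).
  Forest : Rel A 0ℓ → Set
  Forest R = ¬ (∃₂ λ u xs →
    Path (SymClosure R) u xs u × Unique (u ∷ xs) × 2 ≤ length xs)

-- Acyclicity excludes loops, and a relation has no multiple arcs, so these
-- graphs are simple.
record DAG (n : ℕ) : Set₁ where
  field
    Arc     : Rel (Fin n) 0ℓ
    arc?    : Decidable Arc
    acyclic : Acyclic Arc

module _ {n : ℕ} (D : DAG n) where
  open DAG D

  -- The vertices outside S are kept as isolated vertices; they lie on no path
  -- of positive length and no cycle.
  Induced : Subset n → Rel (Fin n) 0ℓ
  Induced S u v = u ∈ S × v ∈ S × Arc u v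

  Vertebrate : Set
  Vertebrate = ∀ (S : Subset n) → Forest (TransitiveReduction (Induced S))

  -- By acyclicity, an arc joining two vertices of a directed path has the
  -- direction of the path.
  Filled : Set
  Filled = ∀ {u xs v} → Path Arc u xs v → Arc u v → AllPairs Arc (u ∷ xs ∷ʳ v)

  Skeletal : Set
  Skeletal = Vertebrate × Filled

------------------------------------------------------------------------
-- Order theory

module Order {c ℓ₁ ℓ₂ : Level} (P : Poset c ℓ₁ ℓ₂) where
  open Poset P using (_≈_) renaming (Carrier to X; _≤_ to _⊑_)
  open ToStrict _≈_ _⊑_ using () renaming (_<_ to _⊏_)

  _⋖_ : Rel X (c ⊔ ℓ₁ ⊔ ℓ₂)
  x ⋖ y = x ⊏ y × ¬ (∃[ z ] (x ⊏ z × z ⊏ y))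

  -- x⋆ , _ : JoinIrreducible x  exhibits the unique element x⋆ covered by x.
  JoinIrreducible : Pred X (c ⊔ ℓ₁ ⊔ ℓ₂)
  JoinIrreducible x = ∃! _≈_ λ x⋆ → x⋆ ⋖ x

  IsJoin : X → X → X → Set (c ⊔ ℓ₂)
  IsJoin x y z = x ⊑ z × y ⊑ z × (∀ w → x ⊑ w → y ⊑ w → z ⊑ w)

  IsMeet : X → X → X → Set (c ⊔ ℓ₂)
  IsMeet x y z = z ⊑ x × z ⊑ y × (∀ w → w ⊑ x → w ⊑ y → w ⊑ z)

  -- When P is a lattice, IsJoin x y z says that z is the join of x and y (and
  -- dually for meets), so this is the usual notion of a lattice congruence.
  record IsCongruence {ℓ : Level} (_∼_ : Rel X ℓ) : Set (c ⊔ ℓ₁ ⊔ ℓ₂ ⊔ ℓ) where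
    field
      isEquivalence : IsEquivalence _∼_
      respects-≈    : _≈_ ⇒ _∼_
      ∨-compatible  : ∀ {x x′ y y′ z z′} → x ∼ x′ → y ∼ y′ →
                      IsJoin x y z → IsJoin x′ y′ z′ → z ∼ z′
      ∧-compatible  : ∀ {x x′ y y′ z z′} → x ∼ x′ → y ∼ y′ →
                      IsMeet x y z → IsMeet x′ y′ z′ → z ∼ z′

  module _ {ℓ : Level} (_∼_ : Rel X ℓ) where

    Contracts : (x : X) → JoinIrreducible x → Set ℓ
    Contracts x (x⋆ , _) = x⋆ ∼ x

    UncontractedJoinIrreducible : Pred X (c ⊔ ℓ₁ ⊔ ℓ₂ ⊔ ℓ)
    UncontractedJoinIrreducible x = Σ[ ji ∈ JoinIrreducible x ] ¬ Contracts x ji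

    MinimalInClass : Pred X (c ⊔ ℓ₁ ⊔ ℓ₂ ⊔ ℓ)
    MinimalInClass x = ∀ y → y ∼ x → y ⊑ x → y ≈ x

    MaximalInClass : Pred X (c ⊔ ℓ₁ ⊔ ℓ₂ ⊔ ℓ)
    MaximalInClass x = ∀ y → y ∼ x → x ⊑ y → x ≈ y

------------------------------------------------------------------------
-- Acyclic reorientations

module _ {n : ℕ} (D : DAG n) where
  open DAG D

  record AcyclicReorientation : Set₁ where
    field
      dag            : DAG n
      sameUnderlying : SymClosure Arc ⇔ SymClosure (DAG.Arc dag)

    open DAG dag public using () renaming (Arc to Arcᴱ)

    Reversed : Rel (Fin n) 0ℓ
    Reversed u v = Arc u v × Arcᴱ v u

  open AcyclicReorientation

  AR : Poset (lsuc 0ℓ) 0ℓ 0ℓ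
  AR = record
    { Carrier        = AcyclicReorientation
    ; _≈_            = λ E F → Reversed E ⇔ Reversed F
    ; _≤_            = λ E F → Reversed E ⇒ Reversed F
    ; isPartialOrder = record
      { isPreorder = record
        { isEquivalence = record
          { refl  = id , id
          ; sym   = λ (f , g) → g , f
          ; trans = λ (f , g) (h , k) → (λ r → h (f r)) , (λ r → g (k r))
          }
        ; reflexive = λ (f , _) → f
        ; trans     = λ f g r → g (f r)
        }
      ; antisym = λ f g → f , g
      }
    }

  TransitiveSupport : Fin n → Fin n → Pred (Fin n) 0ℓ
  TransitiveSupport u v w =
    ∃[ xs ] (Path Arc u xs v × w List.∈ (u ∷ xs ∷ʳ v))

  record Rope : Set where
    field
      u v      : Fin n
      ∇ Δ      : Subset n
      arc      : Arc u v
      disjoint : ∀ {w} → w ∈ ∇ → w ∉ Δ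
      covering : ∀ {w} → (w ∈ ∇ ⊎ w ∈ Δ) Fun.⇔
                         (TransitiveSupport u v w × w ≢ u × w ≢ v)

  -- I∨ is given by its set of reversed arcs, which determines a reorientation.
  I∨ : Rope → Rel (Fin n) 0ℓ
  I∨ ρ w w′ = Arc w w′ × w ∈ Δ ∪ ⁅ u ⁆ × w′ ∈ ∇ ∪ ⁅ v ⁆
    where open Rope ρ

  open Order AR

  -- The relation _∼_ is the coherent congruence of (℧ , Ω).
  record IsCoherentCongruence {ℓ : Level} (℧ Ω : Subset n)
                              (_∼_ : Rel AcyclicReorientation ℓ)
                              : Set (lsuc 0ℓ ⊔ ℓ) where
    field
      isCongruence : IsCongruence _∼_
      uncontracted : ∀ (J : AcyclicReorientation) →
        UncontractedJoinIrreducible _∼_ J Fun.⇔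
        (∃[ ρ ] (Rope.∇ ρ ⊆ ℧ × Rope.Δ ρ ⊆ Ω × (Reversed J ⇔ I∨ ρ)))

  ∇⟨_⟩ : AcyclicReorientation → Fin n → Fin n → Pred (Fin n) 0ℓ
  ∇⟨ E ⟩ u v w = (Arc u w × ¬ Arcᴱ E u w) × (Arc w v × Arcᴱ E w v)

  Δ⟨_⟩ : AcyclicReorientation → Fin n → Fin n → Pred (Fin n) 0ℓ
  Δ⟨ E ⟩ u v w = (Arc u w × Arcᴱ E u w) × (Arc w v × ¬ Arcᴱ E w v)

  -- ∇ and Δ of the arc (u , v) in E are contained in ℧ and Ω respectively.
  Fits : Subset n → Subset n → AcyclicReorientation → Fin n → Fin n → Set
  Fits ℧ Ω E u v =
    (∀ {w} → ∇⟨ E ⟩ u v w → w ∈ ℧) × (∀ {w} → Δ⟨ E ⟩ u v w → w ∈ Ω)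

{-# OPTIONS --safe #-}
module Submission where

-- If E′ is obtained from E by reversing an arc (u , v) of D, let ρ be the rope
-- (u , v , ∇ , Δ) read off E′ and J = I∨ ρ.  Then J ∨ E = E′ and J ∧ E = J⋆, so
-- E ∼ E′ exactly when J is contracted, i.e. unless ∇ ⊆ ℧ and Δ ⊆ Ω.
-- This settles (i) ⇔ (ii), because the arcs of D that can be reversed alone in
-- E are those of its transitive reduction, and congruence classes are convex.
-- For (ii) ⇒ (iii), let w lie in ∇ or Δ of an arc, and follow a path of the
-- transitive reduction of E between the endpoints.  It starts on one side of
-- w in D and ends on the other, without visiting w.  As the transitive
-- reduction of D is a forest and D is filled, some step of the path joins an
-- out-neighbour of w to an in-neighbour of w, and (ii) applies to that step.

open import Defs
open import Data.Empty using (⊥-elim)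
open import Data.Fin.Base using (Fin)
open import Data.Fin.Induction using (spo-wellFounded; spo-noetherian)
open import Data.Fin.Properties using (_≟_; any?)
open import Data.Fin.Subset using (Subset; ⊤; _∈_; _⊆_; _∪_; ⁅_⁆)
open import Data.Fin.Subset.Properties
  using (_∈?_; ∈⊤; x∈p∪q⁻; x∈p∪q⁺; x∈⁅x⁆; x∈⁅y⁆⇒x≡y)
open import Data.List.Base using ([]; _∷_; _∷ʳ_)
import Data.List.Membership.DecPropositional as DecMembership
import Data.List.Membership.Propositional as List
open import Data.List.Membership.Propositional.Properties using (∈-++⁺ʳ)
open import Data.List.Relation.Unary.All as All using (All; []; _∷_)
open import Data.List.Relation.Unary.All.Properties using (¬Any⇒All¬)
open import Data.List.Relation.Unary.AllPairs using (AllPairs; []; _∷_)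
open import Data.List.Relation.Unary.Any using (here; there)
open import Data.List.Relation.Unary.Linked as Linked using (Linked; [-]; _∷_)
open import Data.List.Relation.Unary.Unique.Propositional using (Unique)
open import Data.Nat.Base using (ℕ; z≤n; s≤s)
open import Data.Product.Base using (∃-syntax; _×_; _,_; proj₁; proj₂)
open import Data.Sum.Base as Sum using (_⊎_; inj₁; inj₂; [_,_]′)
open import Data.Vec.Base using (tabulate)
open import Data.Vec.Properties using (lookup∘tabulate; lookup⇒[]=; []=⇒lookup)
open import Function.Base using (flip; _∘_; id)
open import Function.Bundles using (_⇔_; mk⇔; Equivalence)
open import Induction.WellFounded using (Acc; acc; WellFounded)
open import Level using (Level; 0ℓ)
open import Relation.Binary.Construct.Closure.ReflexiveTransitive as Star
  using (Star; ε; _◅_; _◅◅_)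
open import Relation.Binary.Construct.Closure.Symmetric as Sym using (SymClosure; fwd; bwd)
open import Relation.Binary.Construct.Closure.Transitive
  using (TransClosure; [_]; _∷_; _++_)
open import Relation.Binary.Core using (Rel; _⇒_) renaming (_⇔_ to _⇔₂_)
open import Relation.Binary.Definitions using (Decidable)
open import Relation.Binary.PropositionalEquality
  using (_≡_; _≢_; refl; sym; trans; resp₂) renaming (isEquivalence to ≡-isEquivalence)
open import Relation.Binary.Structures using (IsEquivalence; IsStrictPartialOrder)
open import Relation.Nullary.Decidable as Dec
  using (Dec; yes; no; does; _×-dec_; _⊎-dec_; ¬?; dec-true)
open import Relation.Nullary.Negation using (¬_; contradiction)

-- Walks and transitive closures.

module _ {A : Set} {R : Rel A 0ℓ} where

  path⇒⁺ : ∀ {u v} xs → Path R u xs v → TransClosure R u v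
  path⇒⁺ []       (r ∷ [-]) = [ r ]
  path⇒⁺ (_ ∷ xs) (r ∷ p)   = r ∷ path⇒⁺ xs p

  ⁺⇒path : ∀ {u v} → TransClosure R u v → ∃[ xs ] Path R u xs v
  ⁺⇒path [ r ]   = [] , r ∷ [-]
  ⁺⇒path (r ∷ p) with xs , q ← ⁺⇒path p = _ ∷ xs , r ∷ q

  ⁺⇒path-through : ∀ {u v w} → TransClosure R u w → TransClosure R w v →
                   ∃[ xs ] (Path R u xs v × w List.∈ (u ∷ xs ∷ʳ v))
  ⁺⇒path-through [ r ]   q with xs , p ← ⁺⇒path q = _ ∷ xs , r ∷ p , there (here refl)
  ⁺⇒path-through (r ∷ s) q with xs , p , w∈ ← ⁺⇒path-through s q =
    _ ∷ xs , r ∷ p , there w∈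

  ⁺⇒⋆ : TransClosure R ⇒ Star R
  ⁺⇒⋆ [ r ]   = r ◅ ε
  ⁺⇒⋆ (r ∷ p) = r ◅ ⁺⇒⋆ p

  _◅⁺_ : ∀ {u v w} → R u v → Star R v w → TransClosure R u w
  r ◅⁺ ε       = [ r ]
  r ◅⁺ (s ◅ p) = r ∷ (s ◅⁺ p)

  _⋆▻⁺_ : ∀ {u v w} → Star R u v → TransClosure R v w → TransClosure R u w
  ε       ⋆▻⁺ q = q
  (r ◅ p) ⋆▻⁺ q = r ∷ (p ⋆▻⁺ q)

  ⋆⇒⁺ : ∀ {u v} → u ≢ v → Star R u v → TransClosure R u v
  ⋆⇒⁺ u≢v ε       = contradiction refl u≢v
  ⋆⇒⁺ _   (r ◅ p) = r ◅⁺ p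

  acyclic⇒irrefl⁺ : Acyclic R → ∀ {u} → ¬ TransClosure R u u
  acyclic⇒irrefl⁺ ac p = ac (_ , ⁺⇒path p)

  irrefl⁺⇒acyclic : (∀ {u} → ¬ TransClosure R u u) → Acyclic R
  irrefl⁺⇒acyclic irr (_ , xs , p) = irr (path⇒⁺ xs p)

  reduction⇒no-detour : ∀ {u v w} → TransitiveReduction R u v →
                        R u w → ¬ TransClosure R w v
  reduction⇒no-detour (_ , no-path) r p with xs , q ← ⁺⇒path p = no-path (_ , xs , r ∷ q)

  no-detour⇒reduction : ∀ {u v} → R u v → (∀ {w} → R u w → ¬ TransClosure R w v) →
                        TransitiveReduction R u v
  no-detour⇒reduction r no-path = r , λ { (_ , xs , s ∷ p) → no-path s (path⇒⁺ xs p) }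

gmap⁺ : ∀ {A : Set} {R S : Rel A 0ℓ} → R ⇒ S → TransClosure R ⇒ TransClosure S
gmap⁺ f [ r ]   = [ f r ]
gmap⁺ f (r ∷ p) = f r ∷ gmap⁺ f p

module _ {A : Set} {R S : Rel A 0ℓ} where

  private
    R∪S : Rel A 0ℓ
    R∪S x y = R x y ⊎ S x y

  -- Isolating the first `S`-step lets a cycle that mixes both relations be rotated so as to start
  -- right after that step.
  split-at-first : ∀ {x y} → Star R∪S x y →
    Star R x y ⊎ (∃[ a ] ∃[ b ] (Star R x a × S a b × Star R∪S b y))
  split-at-first ε = inj₁ ε
  split-at-first (inj₂ s ◅ p) = inj₂ (_ , _ , ε , s , p)
  split-at-first (inj₁ r ◅ p) with split-at-first p
  ... | inj₁ q                    = inj₁ (r ◅ q)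
  ... | inj₂ (a , b , q , s , q′) = inj₂ (a , b , r ◅ q , s , q′)

  split-at-first⁺ : ∀ {x y} → TransClosure R∪S x y →
    TransClosure R x y ⊎ (∃[ a ] ∃[ b ] (Star R x a × S a b × Star R∪S b y))
  split-at-first⁺ [ inj₁ r ] = inj₁ [ r ]
  split-at-first⁺ [ inj₂ s ] = inj₂ (_ , _ , ε , s , ε)
  split-at-first⁺ (inj₂ s ∷ p) = inj₂ (_ , _ , ε , s , ⁺⇒⋆ p)
  split-at-first⁺ (inj₁ r ∷ p) with split-at-first⁺ p
  ... | inj₁ q                    = inj₁ (r ∷ q)
  ... | inj₂ (a , b , q , s , q′) = inj₂ (a , b , r ◅ q , s , q′)

-- Transitive reductions of finite acyclic relations.

module FiniteAcyclic {n : ℕ} {R : Rel (Fin n) 0ℓ}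
                     (R? : Decidable R) (R-acyclic : Acyclic R) where

  private
    isSPO : IsStrictPartialOrder _≡_ (TransClosure R)
    isSPO = record
      { isEquivalence = ≡-isEquivalence
      ; irrefl        = λ { refl → acyclic⇒irrefl⁺ R-acyclic }
      ; trans         = _++_
      ; <-resp-≈      = resp₂ (TransClosure R)
      }

    ⁺-wellFounded : WellFounded (TransClosure R)
    ⁺-wellFounded = spo-wellFounded isSPO

    ⁺-noetherian : WellFounded (flip (TransClosure R))
    ⁺-noetherian = spo-noetherian isSPO

    first-step : ∀ {u v} → TransClosure R u v → ∃[ w ] (R u w × (w ≡ v ⊎ TransClosure R w v))
    first-step [ r ]   = _ , r , inj₁ refl
    first-step (r ∷ p) = _ , r , inj₂ p

  reachable? : Decidable (TransClosure R)
  reachable? u v = go (⁺-noetherian u)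
    where
    go : ∀ {u} → Acc (flip (TransClosure R)) u → Dec (TransClosure R u v)
    go {u} (acc rec) = Dec.map′
      (λ { (_ , r , inj₁ refl) → [ r ] ; (_ , r , inj₂ p) → r ∷ p })
      first-step
      -- `rec` needs a step from `u` to `w`, so `R? u w` is decided before reachability from `w`.
      (any? (λ w → via w (R? u w)))
      where
      via : ∀ w → Dec (R u w) → Dec (R u w × (w ≡ v ⊎ TransClosure R w v))
      via w (no ¬r) = no (¬r ∘ proj₁)
      via w (yes r) = Dec.map′ (r ,_) proj₂ (w ≟ v ⊎-dec go (rec [ r ]))

  private
    -- If the arc has a detour, continue with the first step of the detour: its head strictly
    -- precedes `v`, whence the induction on `v`.
    first-reduced-step : ∀ {u v} → Acc (TransClosure R) v → R u v →
                         ∃[ w ] (TransitiveReduction R u w × Star R w v)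
    first-reduced-step {u} {v} (acc rec) r
      with any? (λ w → R? u w ×-dec reachable? w v)
    ... | no none = v , no-detour⇒reduction r (λ s p → none (_ , s , p)) , ε
    ... | yes (w , s , p) with x , t , q ← first-reduced-step (rec p) s =
      x , t , q ◅◅ ⁺⇒⋆ p

  -- Refining the first arc may lengthen the remaining walk, so the induction is on the source,
  -- which moves strictly forward.
  ⋆⇒reduction⋆ : ∀ {u v} → Star R u v → Star (TransitiveReduction R) u v
  ⋆⇒reduction⋆ {u} = go (⁺-noetherian u)
    where
    go : ∀ {u v} → Acc (flip (TransClosure R)) u → Star R u v →
         Star (TransitiveReduction R) u v
    go _         ε       = ε
    go (acc rec) (r ◅ p)
      with w , t , q ← first-reduced-step (⁺-wellFounded _) r =
      t ◅ go (rec [ proj₁ t ]) (q ◅◅ p)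

-- Auxiliary facts on lists, and loop erasure.

module _ {A : Set} {S : Rel A 0ℓ} where

  AllPairs-last : ∀ {v w} xs → AllPairs S (xs ∷ʳ v) → w List.∈ (xs ∷ʳ v) → w ≢ v → S w v
  AllPairs-last []       _          (here w≡v)  w≢v = contradiction w≡v w≢v
  AllPairs-last (_ ∷ xs) (px ∷ _)   (here refl) _   = All.lookup px (∈-++⁺ʳ xs (here refl))
  AllPairs-last (_ ∷ xs) (_ ∷ pxs)  (there w∈)  w≢v = AllPairs-last xs pxs w∈ w≢v

module LoopErasure {n : ℕ} {R : Rel (Fin n) 0ℓ} {w : Fin n} where
  open DecMembership (_≟_ {n}) using () renaming (_∈?_ to _∈ᴸ?_)

  -- Since `w` occurs only as the endpoint, a step out of `w` closes the path to a cycle in the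
  -- sense of `Forest`.
  SimplePath : Fin n → Set
  SimplePath x = ∃[ xs ] (Path R x xs w × Unique (x ∷ xs) × All (w ≢_) (x ∷ xs))

  private
    from : ∀ {x zs} → x List.∈ zs → Linked R (zs ∷ʳ w) → Unique zs → All (w ≢_) zs →
           SimplePath x
    from (here refl)              p       u       a       = _ , p , u , a
    from {zs = _ ∷ _ ∷ _} (there x∈) (_ ∷ p) (_ ∷ u) (_ ∷ a) = from x∈ p u a

  erase-loops : ∀ {x} → w ≢ x → Star R x w → SimplePath x
  erase-loops w≢x ε = contradiction refl w≢x
  erase-loops {x} w≢x (_◅_ {j = y} r p) with w ≟ y
  ... | yes refl = [] , r ∷ [-] , [] ∷ [] , w≢x ∷ []
  ... | no w≢y with ys , q , u , a ← erase-loops w≢y p | x ∈ᴸ? (y ∷ ys)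
  ...   | yes x∈ = from x∈ q u a
  ...   | no x∉  = y ∷ ys , r ∷ q , ¬Any⇒All¬ _ x∉ ∷ u , w≢x ∷ a

-- Transitive supports in filled graphs.

module _ {n : ℕ} (D : DAG n) where
  open DAG D

  Arc⇒≢ : ∀ {x y} → Arc x y → x ≢ y
  Arc⇒≢ r refl = acyclic⇒irrefl⁺ acyclic [ r ]

  module _ (filled : Filled D) where

    -- Filledness joins any two vertices of the path, in particular `w` to both ends. The support of
    -- an arc is thus visible in arcs alone.
    support⇒arcs : ∀ {u v w} → Arc u v → TransitiveSupport D u v w → w ≢ u → w ≢ v →
                   Arc u w × Arc w v
    support⇒arcs r (xs , p , here w≡u) w≢u w≢v = contradiction w≡u w≢u
    support⇒arcs r (xs , p , there w∈) w≢u w≢v with px ∷ pxs ← filled p r =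
      All.lookup px w∈ , AllPairs-last xs pxs w∈ w≢v

    between⇒arcs : ∀ {u v w} → Arc u v → TransClosure Arc u w → TransClosure Arc w v →
                   Arc u w × Arc w v
    between⇒arcs r p q = support⇒arcs r (⁺⇒path-through p q)
      (λ { refl → acyclic⇒irrefl⁺ acyclic p }) (λ { refl → acyclic⇒irrefl⁺ acyclic q })

-- Walks around a vertex of a skeletal graph.

module Crossing {n : ℕ} (D : DAG n) (skeletal : Skeletal D) (w : Fin n) where
  open DAG D

  private
    Full T : Rel (Fin n) 0ℓ
    Full = Induced D ⊤
    T    = TransitiveReduction Full

    full-acyclic : Acyclic Full
    full-acyclic (u , xs , p) = acyclic (u , xs , Linked.map (proj₂ ∘ proj₂) p)

    open FiniteAcyclic {R = Full} (λ x y → x ∈? ⊤ ×-dec (y ∈? ⊤ ×-dec arc? x y)) full-acyclic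
      using (⋆⇒reduction⋆)

    reduced : ∀ {x y} → Arc x y → Star T x y
    reduced r = ⋆⇒reduction⋆ ((∈⊤ , ∈⊤ , r) ◅ ε)

    T⇒Arc : T ⇒ Arc
    T⇒Arc t = proj₂ (proj₂ (proj₁ t))

    T⋆⇒Arc⁺ : ∀ {x y} → x ≢ y → Star T x y → TransClosure Arc x y
    T⋆⇒Arc⁺ x≢y p = gmap⁺ T⇒Arc (⋆⇒⁺ x≢y p)

    -- Undirected steps of the forest, except that `w` is entered only along an arc. Going back to
    -- `w` through the edge by which it was left would contradict nothing, and this excludes it.
    Edge : Rel (Fin n) 0ℓ
    Edge x y = SymClosure T x y × (y ≡ w → T x y)

    along : T ⇒ Edge
    along t = fwd t , λ _ → t

    -- The reversal of a step enters its tail, so it is forbidden only when the tail is `w`, and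
    -- then `w` splits the path.
    against : ∀ {x y} → Star T x y → Star Edge y x ⊎ (Star T x w × Star T w y)
    against ε = inj₁ ε
    against {x} (t ◅ p) with against p
    ... | inj₂ (q , q′) = inj₂ (t ◅ q , q′)
    ... | inj₁ q with x ≟ w
    ...   | yes refl = inj₂ (ε , t ◅ p)
    ...   | no x≢w   = inj₁ (q ◅◅ ((bwd t , λ x≡w → contradiction x≡w x≢w) ◅ ε))

    -- Erasing the loops of such a walk and prepending w → p gives a cycle of
    -- the forest T, of length at least 3 because w is entered along an arc.
    no-return : ∀ {p} → T w p → ¬ Star Edge p w
    no-return t q with LoopErasure.erase-loops (Arc⇒≢ D (T⇒Arc t)) q
    ... | [] , e ∷ [-] , _ , _ =
      acyclic⇒irrefl⁺ acyclic (T⇒Arc t ∷ [ T⇒Arc (proj₂ e refl) ])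
    ... | _ ∷ _ , p , u , a =
      proj₁ skeletal ⊤ (w , _ , fwd t ∷ Linked.map proj₁ p , a ∷ u , s≤s (s≤s z≤n))

  -- Let `z` follow `w` on a `T`-path to `x`, and maintain an `Edge`-walk from `z` to the current
  -- vertex. A step along an arc of `D` extends it; a step against an arc extends it too, unless the
  -- `T`-path of that arc visits `w`, which gives the crossing. Without a crossing, the arc from `y`
  -- to `w` would complete a walk forbidden by `no-return`.
  crossing-down : ∀ {R : Rel (Fin n) 0ℓ} → R ⇒ SymClosure Arc → (∀ {x y} → R x y → y ≢ w) →
                  ∀ {x y} → Arc w x → Star R x y → Arc y w →
                  ∃[ a ] ∃[ b ] (R a b × Arc b w × Arc w a)
  crossing-down {R} R⇒sym R-avoids wx p yw with reduced wx
  ... | ε     = contradiction refl (Arc⇒≢ D wx)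
  ... | _◅_ {j = z} t q = go (Star.map along q) (Arc⇒≢ D wx ∘ sym) p yw
    where
    go : ∀ {x y} → Star Edge z x → x ≢ w → Star R x y → Arc y w →
         ∃[ a ] ∃[ b ] (R a b × Arc b w × Arc w a)
    go q x≢w ε       yw = contradiction (q ◅◅ Star.map along (reduced yw)) (no-return t)
    go q x≢w (r ◅ p) yw with R⇒sym r
    ... | fwd xx′ = go (q ◅◅ Star.map along (reduced xx′)) (R-avoids r) p yw
    ... | bwd x′x with against (reduced x′x)
    ...   | inj₁ q′ = go (q ◅◅ q′) (R-avoids r) p yw
    -- Neither end of the arc is `w`, so both halves of the path are nonempty and filledness
    -- applies.
    ...   | inj₂ (q₁ , q₂) = _ , _ , r ,
      between⇒arcs D (proj₂ skeletal) x′x (T⋆⇒Arc⁺ (R-avoids r) q₁) (T⋆⇒Arc⁺ (x≢w ∘ sym) q₂)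

  -- Reading the walk backwards reduces to `crossing-down`; targets become sources in the avoidance
  -- hypothesis.
  crossing-up : ∀ {R : Rel (Fin n) 0ℓ} → R ⇒ SymClosure Arc → (∀ {x y} → R x y → x ≢ w) →
                ∀ {x y} → Arc x w → Star R x y → Arc w y →
                ∃[ a ] ∃[ b ] (R a b × Arc a w × Arc w b)
  crossing-up R⇒sym R-avoids xw p wy
    with a , b , r , bw , wa ← crossing-down (Sym.symmetric _ ∘ R⇒sym) R-avoids
                                 wy (Star.reverse id p) xw =
    b , a , r , bw , wa

-- Arcs of acyclic reorientations.

module _ {n : ℕ} {D : DAG n} where
  open AcyclicReorientation
  open DAG D

  module _ (E : AcyclicReorientation D) where

    arcᴱ? : Decidable (Arcᴱ E)
    arcᴱ? = DAG.arc? (dag E)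

    irrefl⁺ᴱ : ∀ {x} → ¬ TransClosure (Arcᴱ E) x x
    irrefl⁺ᴱ = acyclic⇒irrefl⁺ (DAG.acyclic (dag E))

    reversed? : Decidable (Reversed E)
    reversed? x y = arc? x y ×-dec arcᴱ? y x

    private
      choose : ∀ {x y} → SymClosure (Arcᴱ E) x y → Arcᴱ E x y ⊎ Arcᴱ E y x
      choose (fwd e) = inj₁ e
      choose (bwd e) = inj₂ e

    reorient : ∀ {x y} → Arc x y → Arcᴱ E x y ⊎ Arcᴱ E y x
    reorient r = choose (proj₁ (sameUnderlying E) (fwd r))

    orient⁺ : ∀ {x y} → SymClosure Arc x y → TransClosure (Arcᴱ E) x y → Arcᴱ E x y
    orient⁺ s p with choose (proj₁ (sameUnderlying E) s)
    ... | inj₁ e = e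
    ... | inj₂ e = contradiction (e ∷ p) irrefl⁺ᴱ

    -- Along `u → w → v` in `D`, membership in `∇` means that `w` precedes both ends in `E`, and in
    -- `Δ` that it follows both. Paths of `E` suffice, as acyclicity then forces the orientation of
    -- the arcs.
    ∇⁺ : ∀ {u v w} → Arc u w → Arc w v →
         TransClosure (Arcᴱ E) w u → TransClosure (Arcᴱ E) w v → ∇⟨_⟩ D E u v w
    ∇⁺ uw wv p q = (uw , λ e → irrefl⁺ᴱ (e ∷ p)) , (wv , orient⁺ (fwd wv) q)

    Δ⁺ : ∀ {u v w} → Arc u w → Arc w v →
         TransClosure (Arcᴱ E) u w → TransClosure (Arcᴱ E) v w → Δ⟨_⟩ D E u v w
    Δ⁺ uw wv p q = (uw , orient⁺ (fwd uw) p) , (wv , λ e → irrefl⁺ᴱ (e ∷ q))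

    ∇⁻ : ∀ {u v w} → ∇⟨_⟩ D E u v w → Arcᴱ E w u × Arcᴱ E w v
    ∇⁻ ((uw , ¬e) , (_ , f)) = [ (λ e → contradiction e ¬e) , id ]′ (reorient uw) , f

    Δ⁻ : ∀ {u v w} → Δ⟨_⟩ D E u v w → Arcᴱ E u w × Arcᴱ E v w
    Δ⁻ ((_ , e) , (wv , ¬f)) = e , [ (λ f → contradiction f ¬f) , id ]′ (reorient wv)

    open FiniteAcyclic arcᴱ? (DAG.acyclic (dag E)) using (⋆⇒reduction⋆)

    reduction-walk : ∀ {x y} → Arcᴱ E x y → Star (TransitiveReduction (Arcᴱ E)) x y
    reduction-walk e = ⋆⇒reduction⋆ (e ◅ ε)

  -- An arc of `E` refines to a walk in its reduction, hence in `F`, and acyclicity of `F` orients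
  -- the common edge along that walk.
  reduction-determines : ∀ E F → TransitiveReduction (Arcᴱ E) ⇒ Arcᴱ F → Arcᴱ E ⇒ Arcᴱ F
  reduction-determines E F incl e =
    orient⁺ F (proj₂ (sameUnderlying E) (fwd e))
      (⋆⇒⁺ (λ { refl → irrefl⁺ᴱ E [ e ] }) (Star.map (λ t → incl t) (reduction-walk E e)))

-- From arcs of the transitive reduction to all arcs.

module FitsOnReduction {n : ℕ} {D : DAG n} (skeletal : Skeletal D)
                       (℧ Ω : Subset n) (E : AcyclicReorientation D) where
  open AcyclicReorientation
  open DAG D

  private
    _→⁺_ : Rel (Fin n) 0ℓ
    _→⁺_ = TransClosure (Arcᴱ E)

    T : Rel (Fin n) 0ℓ
    T = TransitiveReduction (Arcᴱ E)

    -- Each step records on which side of `w` its ends lie in `E`: this shows that the walk avoids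
    -- `w`, and puts `w` in `∇` or `Δ` of the crossing step.
    After Before : Fin n → Rel (Fin n) 0ℓ
    After  w a b = T a b × w →⁺ a × w →⁺ b
    Before w a b = T a b × a →⁺ w × b →⁺ w

    T⇒sym : T ⇒ SymClosure Arc
    T⇒sym (e , _) = proj₂ (sameUnderlying E) (fwd e)

    avoids : ∀ {w x} → w →⁺ x → x ≢ w
    avoids p refl = irrefl⁺ᴱ E p

    avoids′ : ∀ {w x} → x →⁺ w → x ≢ w
    avoids′ p refl = irrefl⁺ᴱ E p

    walk-after : ∀ {w x y} → w →⁺ x → Star T x y → Star (After w) x y
    walk-after p ε       = ε
    walk-after p (t ◅ q) = (t , p , p′) ◅ walk-after p′ q
      where p′ = p ++ [ proj₁ t ]

    walk-before : ∀ {w x y} → Star T x y → y →⁺ w → Star (Before w) x y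
    walk-before ε       p = ε
    walk-before (t ◅ q) p = (t , proj₁ t ∷ p′ , p′) ◅ walk-before q p
      where p′ = Star.map proj₁ q ⋆▻⁺ p

    forward : ∀ {a b} → T a b → (∃[ w ] (Arc a w × Arc w b)) → Arc a b
    forward t (w , aw , wb) with T⇒sym t
    ... | fwd ab = ab
    ... | bwd ba = contradiction (aw ∷ wb ∷ [ ba ]) (acyclic⇒irrefl⁺ acyclic)

    backward : ∀ {a b} → T a b → (∃[ w ] (Arc b w × Arc w a)) → Arc b a
    backward t (w , bw , wa) with T⇒sym t
    ... | bwd ba = ba
    ... | fwd ab = contradiction (ab ∷ bw ∷ [ wa ]) (acyclic⇒irrefl⁺ acyclic)

  reversed-fits : (∀ u v → Arc u v → T v u → Fits D ℧ Ω E u v) →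
                  ∀ u v → Arc u v → Arcᴱ E v u → Fits D ℧ Ω E u v
  reversed-fits hyp u v _ vu = in-℧ , in-Ω
    where
    in-℧ : ∀ {w} → ∇⟨_⟩ D E u v w → w ∈ ℧
    -- The walk starts at `v`, which comes after `w` in `E`; hence so do all its vertices.
    in-℧ {w} ((uw , _) , (wv , e))
      with a , b , (t , wa , wb) , bw , aw ←
        Crossing.crossing-down D skeletal w (T⇒sym ∘ proj₁) (avoids ∘ proj₂ ∘ proj₂)
          wv (walk-after [ e ] (reduction-walk E vu)) uw =
      proj₁ (hyp b a (backward t (w , bw , aw)) t) (∇⁺ E bw aw wb wa)

    in-Ω : ∀ {w} → Δ⟨_⟩ D E u v w → w ∈ Ω
    in-Ω {w} ((uw , e) , (wv , _))
      with a , b , (t , wa , wb) , bw , aw ←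
        Crossing.crossing-down D skeletal w (T⇒sym ∘ proj₁) (avoids′ ∘ proj₂ ∘ proj₂)
          wv (walk-before (reduction-walk E vu) [ e ]) uw =
      proj₂ (hyp b a (backward t (w , bw , aw)) t) (Δ⁺ E bw aw wb wa)

  -- The walk now runs from `u` to `v`, hence `crossing-up`. Its position relative to `w` comes from
  -- the arc at `u` for `∇` and at `v` for `Δ`.
  unreversed-fits : (∀ u v → Arc u v → T u v → Fits D ℧ Ω E u v) →
                    ∀ u v → Arc u v → Arcᴱ E u v → Fits D ℧ Ω E u v
  unreversed-fits hyp u v _ uv = in-℧ , in-Ω
    where
    in-℧ : ∀ {w} → ∇⟨_⟩ D E u v w → w ∈ ℧
    in-℧ {w} m@((uw , _) , (wv , _))
      with a , b , (t , wa , wb) , aw , bw ←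
        Crossing.crossing-up D skeletal w (T⇒sym ∘ proj₁) (avoids ∘ proj₁ ∘ proj₂)
          uw (walk-after [ proj₁ (∇⁻ E m) ] (reduction-walk E uv)) wv =
      proj₁ (hyp a b (forward t (w , aw , bw)) t) (∇⁺ E aw bw wa wb)

    in-Ω : ∀ {w} → Δ⟨_⟩ D E u v w → w ∈ Ω
    in-Ω {w} m@((uw , _) , (wv , _))
      with a , b , (t , wa , wb) , aw , bw ←
        Crossing.crossing-up D skeletal w (T⇒sym ∘ proj₁) (avoids′ ∘ proj₁ ∘ proj₂)
          uw (walk-before (reduction-walk E uv) [ proj₂ (Δ⁻ E m) ]) wv =
      proj₂ (hyp a b (forward t (w , aw , bw)) t) (Δ⁺ E aw bw wa wb)

-- Reversing one arc of the transitive reduction.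

module Flip {n : ℕ} {D : DAG n} (E : AcyclicReorientation D) {c d : Fin n}
            (reduced : TransitiveReduction (AcyclicReorientation.Arcᴱ E) c d) where
  open AcyclicReorientation

  private
    Kept New : Rel (Fin n) 0ℓ
    Kept a b = Arcᴱ E a b × ¬ (a ≡ c × b ≡ d)
    New  a b = a ≡ d × b ≡ c

    FlippedArc : Rel (Fin n) 0ℓ
    FlippedArc a b = Kept a b ⊎ New a b

    -- Such a path omits the arc `(c , d)`, so it has length at least two and is a detour.
    no-kept-path : ¬ Star Kept c d
    no-kept-path ε                       = irrefl⁺ᴱ E [ proj₁ reduced ]
    no-kept-path ((_ , other) ◅ ε)       = other (refl , refl)
    no-kept-path ((e , _) ◅ (e′ ◅ p))    =
      reduction⇒no-detour reduced e (gmap⁺ proj₁ (e′ ◅⁺ p))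

    no-path : ¬ Star FlippedArc c d
    no-path p with split-at-first p
    ... | inj₁ q                              = no-kept-path q
    ... | inj₂ (_ , _ , q , (refl , refl) , _) = no-kept-path q

    no-cycle : ∀ {x} → ¬ TransClosure FlippedArc x x
    no-cycle p with split-at-first⁺ p
    ... | inj₁ q                                = irrefl⁺ᴱ E (gmap⁺ proj₁ q)
    -- Rotate the cycle so that it starts after the new arc: what precedes that arc again is a path
    -- from `c` to `d`.
    ... | inj₂ (_ , _ , q , (refl , refl) , q′) = no-path (q′ ◅◅ Star.map inj₁ q)

    new? : Decidable New
    new? a b = (a ≟ d) ×-dec (b ≟ c)

    old? : ∀ a b → Dec (a ≡ c × b ≡ d)
    old? a b = (a ≟ c) ×-dec (b ≟ d)

  up : ∀ {a b} → Arcᴱ E a b → (a ≡ c × b ≡ d) ⊎ FlippedArc a b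
  up {a} {b} e with old? a b
  ... | yes eq = inj₁ eq
  ... | no ¬eq = inj₂ (inj₁ (e , ¬eq))

  down : ∀ {a b} → FlippedArc a b → (a ≡ d × b ≡ c) ⊎ Arcᴱ E a b
  down (inj₁ (e , _)) = inj₂ e
  down (inj₂ eq)      = inj₁ eq

  private
    up-sym : Arcᴱ E ⇒ SymClosure FlippedArc
    up-sym e with up e
    ... | inj₁ (refl , refl) = bwd (inj₂ (refl , refl))
    ... | inj₂ f             = fwd f

    down-sym : FlippedArc ⇒ SymClosure (Arcᴱ E)
    down-sym f with down f
    ... | inj₁ (refl , refl) = bwd (proj₁ reduced)
    ... | inj₂ e             = fwd e

  flipped : AcyclicReorientation D
  flipped = record
    { dag = record
      { Arc     = FlippedArc
      ; arc?    = λ a b → (arcᴱ? E a b ×-dec ¬? (old? a b)) ⊎-dec new? a b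
      ; acyclic = irrefl⁺⇒acyclic no-cycle
      }
    ; sameUnderlying =
        Sym.fold (Sym.symmetric _) up-sym ∘ proj₁ (sameUnderlying E) ,
        proj₂ (sameUnderlying E) ∘ Sym.fold (Sym.symmetric _) down-sym
    }

-- Cover relations.

module _ {n : ℕ} {D : DAG n} where
  open AcyclicReorientation
  open DAG D
  open Order (AR D)

  infix 4 _⊑_
  _⊑_ : Rel (AcyclicReorientation D) 0ℓ
  E ⊑ F = ∀ {a b} → Reversed E a b → Reversed F a b

  -- Both reorientations are parameters, so that the one produced by `flipped` can be either the
  -- upper or the lower one.
  record Cover (E E′ : AcyclicReorientation D) (u v : Fin n) : Set where
    field
      arc  : Arc u v
      old  : Arcᴱ E u v
      new  : Arcᴱ E′ v u
      up   : ∀ {a b} → Arcᴱ E a b → (a ≡ u × b ≡ v) ⊎ Arcᴱ E′ a b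
      down : ∀ {a b} → Arcᴱ E′ a b → (a ≡ v × b ≡ u) ⊎ Arcᴱ E a b

    lower⊑upper : E ⊑ E′
    lower⊑upper (ab , ba) with up ba
    ... | inj₁ (refl , refl) = contradiction (ab ∷ [ arc ]) (acyclic⇒irrefl⁺ acyclic)
    ... | inj₂ e             = ab , e

    unreversed : ¬ Reversed E u v
    unreversed (_ , vu) = irrefl⁺ᴱ E (vu ∷ [ old ])

    -- The pair `(u , v)` is the only reversed arc of `E′` that `E` lacks. Together with `above`,
    -- this gives the universal properties of the meets and joins used later.
    below : ∀ F → F ⊑ E′ → ¬ Reversed F u v → F ⊑ E
    below F F⊑E′ ¬uv r with down (proj₂ (F⊑E′ r))
    ... | inj₁ (refl , refl) = contradiction r ¬uv
    ... | inj₂ e             = proj₁ r , e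

    above : ∀ F → E ⊑ F → Reversed F u v → E′ ⊑ F
    above F E⊑F uv (ab , ba) with down ba
    ... | inj₁ (refl , refl) = uv
    ... | inj₂ e             = E⊑F (ab , e)

    covers : E ⋖ E′
    covers = (lower⊑upper , λ (_ , E′⊑E) → unreversed (E′⊑E (arc , new))) , none-between
      where
      none-between : ¬ (∃[ F ] ((E ⊑ F × ¬ (Reversed E ⇔₂ Reversed F)) ×
                                (F ⊑ E′ × ¬ (Reversed F ⇔₂ Reversed E′))))
      none-between (F , (E⊑F , E≉F) , F⊑E′ , F≉E′) with reversed? F u v
      ... | yes uv = F≉E′ (F⊑E′ , above F E⊑F uv)
      ... | no ¬uv = E≉F (E⊑F , below F F⊑E′ ¬uv)

  cover-above : ∀ E {u v} → Arc u v → (t : TransitiveReduction (Arcᴱ E) u v) →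
                Cover E (Flip.flipped E t) u v
  cover-above E uv t = record
    { arc = uv ; old = proj₁ t ; new = inj₂ (refl , refl) ; up = up ; down = down }
    where open Flip E t

  -- The same flip read from its other side, so `up` and `down` exchange roles.
  cover-below : ∀ E {u v} → Arc u v → (t : TransitiveReduction (Arcᴱ E) v u) →
                Cover (Flip.flipped E t) E u v
  cover-below E uv t = record
    { arc = uv ; old = inj₂ (refl , refl) ; new = proj₁ t ; up = down ; down = up }
    where open Flip E t

-- The join irreducible of a rope.

module RopeJoinIrreducible {n : ℕ} {D : DAG n} (filled : Filled D) (ρ : Rope D) where
  open AcyclicReorientation
  open DAG D
  open Rope ρ
  open Order (AR D)
  open Equivalence

  private
    Low High : Fin n → Set
    Low  x = x ∈ Δ ∪ ⁅ u ⁆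
    High x = x ∈ ∇ ∪ ⁅ v ⁆

    Crosses : Rel (Fin n) 0ℓ
    Crosses = I∨ D ρ

    crosses? : Decidable Crosses
    crosses? x y = arc? x y ×-dec (x ∈? _ ×-dec y ∈? _)

    u∈Low : Low u
    u∈Low = x∈p∪q⁺ (inj₂ (x∈⁅x⁆ u))

    v∈High : High v
    v∈High = x∈p∪q⁺ {p = ∇} (inj₂ (x∈⁅x⁆ v))

    arcs : ∀ {w} → w ∈ ∇ ⊎ w ∈ Δ → Arc u w × Arc w v
    arcs m with s , w≢u , w≢v ← to covering m = support⇒arcs D filled arc s w≢u w≢v

  arcs-∇ : ∀ {w} → w ∈ ∇ → Arc u w × Arc w v
  arcs-∇ = arcs ∘ inj₁

  arcs-Δ : ∀ {w} → w ∈ Δ → Arc u w × Arc w v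
  arcs-Δ = arcs ∘ inj₂

  low : ∀ {w} → Low w → w ≡ u ⊎ w ∈ Δ
  low m = Sum.swap (Sum.map id (x∈⁅y⁆⇒x≡y u) (x∈p∪q⁻ Δ _ m))

  high : ∀ {w} → High w → w ≡ v ⊎ w ∈ ∇
  high m = Sum.swap (Sum.map id (x∈⁅y⁆⇒x≡y v) (x∈p∪q⁻ ∇ _ m))

  private
    disjoint′ : ∀ {w} → Low w → ¬ High w
    disjoint′ l h with low l | high h
    ... | inj₁ refl | inj₁ u≡v  = Arc⇒≢ D arc u≡v
    ... | inj₁ refl | inj₂ u∈∇  = Arc⇒≢ D (proj₁ (arcs-∇ u∈∇)) refl
    ... | inj₂ v∈Δ  | inj₁ refl = Arc⇒≢ D (proj₂ (arcs-Δ v∈Δ)) refl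
    ... | inj₂ w∈Δ  | inj₂ w∈∇  = disjoint w∈∇ w∈Δ

    low⇒⋆ : ∀ {w} → Low w → Star Arc u w
    low⇒⋆ l with low l
    ... | inj₁ refl = ε
    ... | inj₂ w∈Δ  = proj₁ (arcs-Δ w∈Δ) ◅ ε

    high⇒⋆ : ∀ {w} → High w → Star Arc w v
    high⇒⋆ h with high h
    ... | inj₁ refl = ε
    ... | inj₂ w∈∇  = proj₂ (arcs-∇ w∈∇) ◅ ε

    between : ∀ {w} → Star Arc u w → Star Arc w v → Low w ⊎ High w
    between {w} p q with w ≟ u | w ≟ v
    ... | yes refl | _        = inj₁ u∈Low
    ... | no _     | yes refl = inj₂ v∈High
    ... | no w≢u   | no w≢v
      with from covering (⁺⇒path-through (⋆⇒⁺ (w≢u ∘ sym) p) (⋆⇒⁺ w≢v q) , w≢u , w≢v)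
    ...   | inj₁ w∈∇ = inj₂ (x∈p∪q⁺ (inj₁ w∈∇))
    ...   | inj₂ w∈Δ = inj₁ (x∈p∪q⁺ (inj₁ w∈Δ))

    Kept JArc : Rel (Fin n) 0ℓ
    Kept a b = Arc a b × ¬ Crosses a b
    JArc a b = Kept a b ⊎ Crosses b a

    -- The support of (u , v) is convex and every arc of D from Low to High is
    -- reversed in J, so a path of J starting in Low never reaches High.
    Escaped : Fin n → Set
    Escaped x = Star Arc u x × ¬ High x

    low⇒escaped : ∀ {x} → Low x → Escaped x
    low⇒escaped l = low⇒⋆ l , disjoint′ l

    escaped-step : ∀ {x y} → Escaped x → JArc x y → Escaped y
    escaped-step (p , ¬h) (inj₂ (_ , _ , h)) = contradiction h ¬h
    -- If `y` were in `High`, then `x` would lie between `u` and `v` but outside `High`, hence in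
    -- `Low`, and the arc would not be kept.
    escaped-step {x} {y} (p , ¬h) (inj₁ (r , ¬c)) = p ◅◅ (r ◅ ε) , λ h →
      [ (λ l → ¬c (r , l , h)) , ¬h ]′ (between p (r ◅ high⇒⋆ h))

    escaped-walk : ∀ {x y} → Escaped x → Star JArc x y → Escaped y
    escaped-walk e ε       = e
    escaped-walk e (r ◅ p) = escaped-walk (escaped-step e r) p

    J-irrefl : ∀ {x} → ¬ TransClosure JArc x x
    J-irrefl p with split-at-first⁺ p
    ... | inj₁ q = acyclic⇒irrefl⁺ acyclic (gmap⁺ proj₁ q)
    -- After the reversed arc the cycle is in `Low`, and it must return to the `High` end.
    ... | inj₂ (_ , _ , q , (_ , l , h) , q′) =
      proj₂ (escaped-walk (low⇒escaped l) (q′ ◅◅ Star.map inj₁ q)) h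

    J-sym : Arc ⇒ SymClosure JArc
    J-sym {a} {b} r with crosses? a b
    ... | yes c = bwd (inj₂ c)
    ... | no ¬c = fwd (inj₁ (r , ¬c))

    J-sym⁻ : JArc ⇒ SymClosure Arc
    J-sym⁻ (inj₁ (r , _)) = fwd r
    J-sym⁻ (inj₂ (r , _)) = bwd r

  J : AcyclicReorientation D
  J = record
    { dag = record
      { Arc     = JArc
      ; arc?    = λ a b → (arc? a b ×-dec ¬? (crosses? a b)) ⊎-dec crosses? b a
      ; acyclic = irrefl⁺⇒acyclic J-irrefl
      }
    ; sameUnderlying = Sym.fold (Sym.symmetric _) J-sym , Sym.fold (Sym.symmetric _) J-sym⁻
    }

  J-reversed : Reversed J ⇔₂ I∨ D ρ
  J-reversed = only , λ c → proj₁ c , inj₂ c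
    where
    only : Reversed J ⇒ I∨ D ρ
    only (r , inj₁ (s , _)) = contradiction (r ∷ [ s ]) (acyclic⇒irrefl⁺ acyclic)
    only (_ , inj₂ c)       = c

  private
    escaped-from-v : ∀ {x} → JArc v x → Escaped x
    escaped-from-v (inj₂ (_ , l , _)) = low⇒escaped l
    escaped-from-v (inj₁ (r , _)) =
      arc ◅ r ◅ ε , λ h → acyclic⇒irrefl⁺ acyclic (r ◅⁺ high⇒⋆ h)

    u-not-entered : ∀ {x} → Escaped x → ¬ TransClosure JArc x u
    u-not-entered e (r ∷ p)                   = u-not-entered (escaped-step e r) p
    u-not-entered (p , _) [ inj₁ (r , _) ]     = acyclic⇒irrefl⁺ acyclic (p ⋆▻⁺ [ r ])
    u-not-entered (_ , ¬h) [ inj₂ (_ , _ , h) ] = ¬h h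

    -- The first step of a detour from `v` leads to an escaped vertex, from which `u` cannot be
    -- entered. So `(u , v)` can be unreversed alone.
    reduced : TransitiveReduction JArc v u
    reduced = no-detour⇒reduction (inj₂ (arc , u∈Low , v∈High)) (u-not-entered ∘ escaped-from-v)

  J⋆ : AcyclicReorientation D
  J⋆ = Flip.flipped J reduced

  J-cover : Cover J⋆ J u v
  J-cover = cover-below J arc reduced

  private
    module C = Cover J-cover

    -- An arc from `u` into `Δ` ends outside `High`, so `J` leaves it unreversed, and so does
    -- everything below `J`.
    low-stays : ∀ F → F ⊑ J → ∀ {w} → Low w → Star (Arcᴱ F) u w
    low-stays F F⊑J l with low l
    ... | inj₁ refl = ε
    ... | inj₂ w∈Δ with r , _ ← arcs-Δ w∈Δ with reorient F r
    ...   | inj₁ f = f ◅ ε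
    ...   | inj₂ f with _ , _ , h ← proj₁ J-reversed (F⊑J (r , f)) =
      contradiction h (disjoint′ l)

    high-stays : ∀ F → F ⊑ J → ∀ {w} → High w → Star (Arcᴱ F) w v
    high-stays F F⊑J h with high h
    ... | inj₁ refl = ε
    ... | inj₂ w∈∇ with _ , r ← arcs-∇ w∈∇ with reorient F r
    ...   | inj₁ f = f ◅ ε
    ...   | inj₂ f with _ , l , _ ← proj₁ J-reversed (F⊑J (r , f)) =
      contradiction h (disjoint′ l)

  -- An unreversed arc from `Low` to `High` would close a cycle through `v → u` in `F`.
  J-below : ∀ F → (∀ {w} → Low w → Star (Arcᴱ F) u w) → (∀ {w} → High w → Star (Arcᴱ F) w v) →
            Reversed F u v → J ⊑ F
  J-below F from-u to-v (_ , vu) c with r , l , h ← proj₁ J-reversed c with reorient F r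
  ... | inj₂ f = r , f
  ... | inj₁ f = contradiction (vu ∷ (from-u l ⋆▻⁺ (f ◅⁺ to-v h))) (irrefl⁺ᴱ F)

  -- By `J-below`, anything strictly below `J` leaves `(u , v)` unreversed, so it lies below `J⋆`; a
  -- lower cover must then equal `J⋆`.
  J-joinIrreducible : JoinIrreducible J
  J-joinIrreducible = J⋆ , C.covers , λ {y} → unique y
    where
    unique : ∀ y → y ⋖ J → Reversed J⋆ ⇔₂ Reversed y
    unique y ((y⊑J , y≉J) , tight) = J⋆⊑y , y⊑J⋆
      where
      y⊑J⋆ : y ⊑ J⋆
      y⊑J⋆ = C.below y y⊑J λ uv →
        y≉J (y⊑J , J-below y (low-stays y y⊑J) (high-stays y y⊑J) uv)

      J⋆⊑y : J⋆ ⊑ y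
      J⋆⊑y {a} {b} r with reversed? y a b
      ... | yes s = s
      ... | no ¬s = ⊥-elim
        (tight (J⋆ , (y⊑J⋆ , λ (_ , J⋆⊑y) → ¬s (J⋆⊑y r)) , proj₁ C.covers))

-- Ropes are determined by their reversed arcs.

module _ {n : ℕ} {D : DAG n} (filled : Filled D) where
  open DAG D

  private
    -- The arc of `ρ` is itself reversed, which places its ends between those of `σ`. Applied both
    -- ways, this identifies the endpoints.
    endpoints : ∀ (ρ σ : Rope D) → I∨ D ρ ⇒ I∨ D σ →
                Star Arc (Rope.u σ) (Rope.u ρ) × Star Arc (Rope.v ρ) (Rope.v σ)
    endpoints ρ σ ρ⇒σ
      with _ , l , h ← ρ⇒σ (Rope.arc ρ , x∈p∪q⁺ {p = Rope.Δ ρ} (inj₂ (x∈⁅x⁆ _))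
                                       , x∈p∪q⁺ {p = Rope.∇ ρ} (inj₂ (x∈⁅x⁆ _))) =
      start (low l) , end (high h)
      where
      open RopeJoinIrreducible filled σ
      start : ∀ {w} → w ≡ Rope.u σ ⊎ w ∈ Rope.Δ σ → Star Arc (Rope.u σ) w
      start (inj₁ refl) = ε
      start (inj₂ w∈Δ)  = proj₁ (arcs-Δ w∈Δ) ◅ ε
      end : ∀ {w} → w ≡ Rope.v σ ⊎ w ∈ Rope.∇ σ → Star Arc w (Rope.v σ)
      end (inj₁ refl) = ε
      end (inj₂ w∈∇)  = proj₂ (arcs-∇ w∈∇) ◅ ε

    ⋆-antisym : ∀ {x y} → Star Arc x y → Star Arc y x → x ≡ y
    ⋆-antisym ε       _ = refl
    ⋆-antisym (r ◅ p) q = contradiction (r ◅⁺ (p ◅◅ q)) (acyclic⇒irrefl⁺ acyclic)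

  -- Once the endpoints agree, `∇` is recognised by the reversed arcs out of `u` and `Δ` by those
  -- into `v`.
  I∨-injective : ∀ (ρ σ : Rope D) → I∨ D ρ ⇔₂ I∨ D σ →
                 Rope.∇ ρ ⊆ Rope.∇ σ × Rope.Δ ρ ⊆ Rope.Δ σ
  I∨-injective ρ σ (ρ⇒σ , σ⇒ρ) = sub-∇ , sub-Δ
    where
    module ρ = Rope ρ
    module σ = Rope σ
    open RopeJoinIrreducible filled ρ using (arcs-∇; arcs-Δ)
    open RopeJoinIrreducible filled σ using (low; high)

    u≡u : ρ.u ≡ σ.u
    u≡u = ⋆-antisym (proj₁ (endpoints σ ρ σ⇒ρ)) (proj₁ (endpoints ρ σ ρ⇒σ))

    v≡v : ρ.v ≡ σ.v
    v≡v = ⋆-antisym (proj₂ (endpoints ρ σ ρ⇒σ)) (proj₂ (endpoints σ ρ σ⇒ρ))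

    sub-∇ : ∀ {w} → w ∈ ρ.∇ → w ∈ σ.∇
    sub-∇ w∈∇ with uw , wv ← arcs-∇ w∈∇
      with _ , _ , h ← ρ⇒σ (uw , x∈p∪q⁺ {p = ρ.Δ} (inj₂ (x∈⁅x⁆ _)) , x∈p∪q⁺ (inj₁ w∈∇))
      with high h
    ... | inj₂ w∈  = w∈
    ... | inj₁ w≡v = contradiction (trans w≡v (sym v≡v)) (Arc⇒≢ D wv)

    sub-Δ : ∀ {w} → w ∈ ρ.Δ → w ∈ σ.Δ
    sub-Δ w∈Δ with uw , wv ← arcs-Δ w∈Δ
      with _ , l , _ ← ρ⇒σ (wv , x∈p∪q⁺ (inj₁ w∈Δ) , x∈p∪q⁺ {p = ρ.∇} (inj₂ (x∈⁅x⁆ _)))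
      with low l
    ... | inj₂ w∈  = w∈
    ... | inj₁ w≡u = contradiction (trans u≡u (sym w≡u)) (Arc⇒≢ D uw)

-- Subsets from decidable predicates.

fromDecidable : ∀ {n} {P : Fin n → Set} → (∀ x → Dec (P x)) → Subset n
fromDecidable P? = tabulate (does ∘ P?)

module _ {n : ℕ} {P : Fin n → Set} (P? : ∀ x → Dec (P x)) where

  ∈-fromDecidable⁺ : ∀ {x} → P x → x ∈ fromDecidable P?
  ∈-fromDecidable⁺ {x} p = lookup⇒[]= x _ (trans (lookup∘tabulate _ x) (dec-true (P? x) p))

  ∈-fromDecidable⁻ : ∀ {x} → x ∈ fromDecidable P? → P x
  ∈-fromDecidable⁻ {x} m with P? x | trans (sym (lookup∘tabulate (does ∘ P?) x)) ([]=⇒lookup m)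
  ... | yes p | _  = p
  ... | no _  | ()

-- The rope of a cover relation and its contraction.

module CoverRope {n : ℕ} {D : DAG n} (filled : Filled D)
                 {E E′ : AcyclicReorientation D} {u v : Fin n} (cover : Cover E E′ u v) where
  open AcyclicReorientation
  open DAG D
  open Cover cover
  open Order (AR D)

  private
    ∇? : ∀ w → Dec (∇⟨_⟩ D E′ u v w)
    ∇? w = (arc? u w ×-dec ¬? (arcᴱ? E′ u w)) ×-dec (arc? w v ×-dec arcᴱ? E′ w v)

    Δ? : ∀ w → Dec (Δ⟨_⟩ D E′ u v w)
    Δ? w = (arc? u w ×-dec arcᴱ? E′ u w) ×-dec (arc? w v ×-dec ¬? (arcᴱ? E′ w v))

    support : ∀ {w} → Arc u w → Arc w v → TransitiveSupport D u v w × w ≢ u × w ≢ v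
    support uw wv = ⁺⇒path-through [ uw ] [ wv ] , Arc⇒≢ D uw ∘ sym , Arc⇒≢ D wv

    -- Exactly one of `(u , w)` and `(w , v)` is reversed: with neither, `v → u` closes a cycle in
    -- `E′`; with both, `u → v` closes one in `E`.
    classify : ∀ {w} → TransitiveSupport D u v w × w ≢ u × w ≢ v →
               ∇⟨_⟩ D E′ u v w ⊎ Δ⟨_⟩ D E′ u v w
    classify (s , w≢u , w≢v) with uw , wv ← support⇒arcs D filled arc s w≢u w≢v
      with reorient E′ uw | reorient E′ wv
    ... | inj₁ e | inj₁ f = contradiction (e ∷ f ∷ [ new ]) (irrefl⁺ᴱ E′)
    ... | inj₁ e | inj₂ f = inj₂ (Δ⁺ E′ uw wv [ e ] [ f ])
    ... | inj₂ e | inj₁ f = inj₁ (∇⁺ E′ uw wv [ e ] [ f ])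
    ... | inj₂ e | inj₂ f with down e | down f
    ...   | inj₁ (w≡v , _) | _              = contradiction w≡v w≢v
    ...   | _              | inj₁ (_ , w≡u) = contradiction w≡u w≢u
    ...   | inj₂ e′        | inj₂ f′        = contradiction (f′ ∷ e′ ∷ [ old ]) (irrefl⁺ᴱ E)

  rope : Rope D
  rope = record
    { u = u ; v = v ; ∇ = fromDecidable ∇? ; Δ = fromDecidable Δ? ; arc = arc
    ; disjoint = λ a b → proj₂ (proj₂ (∈-fromDecidable⁻ Δ? b))
                               (proj₂ (proj₂ (∈-fromDecidable⁻ ∇? a)))
    ; covering = mk⇔
        [ (λ m → let (uw , _) , (wv , _) = ∈-fromDecidable⁻ ∇? m in support uw wv)
        , (λ m → let (uw , _) , (wv , _) = ∈-fromDecidable⁻ Δ? m in support uw wv) ]′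
        (Sum.map (∈-fromDecidable⁺ ∇?) (∈-fromDecidable⁺ Δ?) ∘ classify)
    }

  open RopeJoinIrreducible filled rope

  private
    module C = Cover J-cover

    J⊑E′ : J ⊑ E′
    J⊑E′ = J-below E′ from-u to-v (arc , new)
      where
      from-u : ∀ {w} → w ∈ fromDecidable Δ? ∪ ⁅ u ⁆ → Star (Arcᴱ E′) u w
      from-u l with low l
      ... | inj₁ refl = ε
      ... | inj₂ m    = proj₁ (Δ⁻ E′ (∈-fromDecidable⁻ Δ? m)) ◅ ε
      to-v : ∀ {w} → w ∈ fromDecidable ∇? ∪ ⁅ v ⁆ → Star (Arcᴱ E′) w v
      to-v h with high h
      ... | inj₁ refl = ε
      ... | inj₂ m    = proj₂ (∇⁻ E′ (∈-fromDecidable⁻ ∇? m)) ◅ ε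

    J⋆⊑E : J⋆ ⊑ E
    J⋆⊑E = below J⋆ (J⊑E′ ∘ C.lower⊑upper) C.unreversed

  module _ {ℓ : Level} {_∼_ : Rel (AcyclicReorientation D) ℓ}
           (isCongruence : IsCongruence _∼_) where
    open IsCongruence isCongruence
    private module ∼ = IsEquivalence isEquivalence

    -- Join `J⋆` and `J` with `E`: the results are `E` and `E′`, because a bound above `J` reverses
    -- `(u , v)`.
    J⋆∼J⇒E∼E′ : J⋆ ∼ J → E ∼ E′
    J⋆∼J⇒E∼E′ J⋆∼J = ∨-compatible (∼.refl {E}) J⋆∼J
      (id , J⋆⊑E , λ _ E⊑F _ → E⊑F)
      (lower⊑upper , J⊑E′ , λ F E⊑F J⊑F → above F E⊑F (J⊑F (arc , C.new)))

    -- Meet `E` and `E′` with `J`: the results are `J⋆` and `J`, because a bound below `E` does not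
    -- reverse `(u , v)`.
    E∼E′⇒J⋆∼J : E ∼ E′ → J⋆ ∼ J
    E∼E′⇒J⋆∼J E∼E′ = ∧-compatible E∼E′ (∼.refl {J})
      (J⋆⊑E , C.lower⊑upper , λ F F⊑E F⊑J → C.below F F⊑J (unreversed ∘ F⊑E))
      (J⊑E′ , id , λ _ _ F⊑J → F⊑J)

  module _ {ℓ : Level} {℧ Ω : Subset n} {_∼_ : Rel (AcyclicReorientation D) ℓ}
           (coherent : IsCoherentCongruence D ℧ Ω _∼_) where
    open IsCoherentCongruence coherent
    open IsCongruence isCongruence
    open Equivalence
    private module ∼ = IsEquivalence isEquivalence

    fits⇒≁ : Fits D ℧ Ω E′ u v → ¬ (E ∼ E′)
    fits⇒≁ (in-℧ , in-Ω) E∼E′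
      with (x⋆ , _ , unique) , x⋆≁J ← from (uncontracted J)
        (rope , in-℧ ∘ ∈-fromDecidable⁻ ∇? , in-Ω ∘ ∈-fromDecidable⁻ Δ? , J-reversed) =
      -- The hypothesis brings its own lower cover `x⋆` of `J`; uniqueness identifies it with `J⋆`.
      x⋆≁J (∼.trans (respects-≈ {x⋆} {J⋆} (unique {J⋆} C.covers))
                     (E∼E′⇒J⋆∼J isCongruence E∼E′))

    -- Coherence yields some rope `σ` with the same reversed arcs as `J`; injectivity carries its
    -- inclusions over to `rope`.
    ≁⇒fits : ¬ (E ∼ E′) → Fits D ℧ Ω E′ u v
    ≁⇒fits E≁E′
      with σ , ∇⊆ , Δ⊆ , J≈σ ← to (uncontracted J)
        (J-joinIrreducible , E≁E′ ∘ J⋆∼J⇒E∼E′ isCongruence)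
      with sub-∇ , sub-Δ ← I∨-injective filled rope σ
        ((λ c → proj₁ J≈σ (proj₂ J-reversed c)) , (λ c → proj₁ J-reversed (proj₂ J≈σ c))) =
      (λ m → ∇⊆ (sub-∇ (∈-fromDecidable⁺ ∇? m))) , (λ m → Δ⊆ (sub-Δ (∈-fromDecidable⁺ Δ? m)))

  private
    lift : ∀ {w x} → (x ≢ u ⊎ w ≢ v) → Arcᴱ E x w → Arcᴱ E′ x w
    lift other e with up e
    ... | inj₁ (x≡u , w≡v) = contradiction other λ { (inj₁ x≢u) → x≢u x≡u ; (inj₂ w≢v) → w≢v w≡v }
    ... | inj₂ e′          = e′

    lower : ∀ {w x} → (x ≢ v ⊎ w ≢ u) → Arcᴱ E′ x w → Arcᴱ E x w
    lower other e with down e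
    ... | inj₁ (x≡v , w≡u) = contradiction other λ { (inj₁ x≢v) → x≢v x≡v ; (inj₂ w≢u) → w≢u w≡u }
    ... | inj₂ e′          = e′

  -- The sets `∇` and `Δ` of `(u , v)` depend only on arcs at a third vertex `w`, which the flip
  -- does not touch.
  fits-lower : ∀ {℧ Ω} → Fits D ℧ Ω E′ u v → Fits D ℧ Ω E u v
  fits-lower (in-℧ , in-Ω) = (in-℧ ∘ ∇-up) , (in-Ω ∘ Δ-up)
    where
    ∇-up : ∀ {w} → ∇⟨_⟩ D E u v w → ∇⟨_⟩ D E′ u v w
    ∇-up m@((uw , _) , (wv , _)) with wu , w→v ← ∇⁻ E m =
      ∇⁺ E′ uw wv [ lift (inj₁ (Arc⇒≢ D uw ∘ sym)) wu ] [ lift (inj₁ (Arc⇒≢ D uw ∘ sym)) w→v ]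
    Δ-up : ∀ {w} → Δ⟨_⟩ D E u v w → Δ⟨_⟩ D E′ u v w
    Δ-up m@((uw , _) , (wv , _)) with u→w , vw ← Δ⁻ E m =
      Δ⁺ E′ uw wv [ lift (inj₂ (Arc⇒≢ D wv)) u→w ] [ lift (inj₂ (Arc⇒≢ D wv)) vw ]

  fits-upper : ∀ {℧ Ω} → Fits D ℧ Ω E u v → Fits D ℧ Ω E′ u v
  fits-upper (in-℧ , in-Ω) = (in-℧ ∘ ∇-down) , (in-Ω ∘ Δ-down)
    where
    ∇-down : ∀ {w} → ∇⟨_⟩ D E′ u v w → ∇⟨_⟩ D E u v w
    ∇-down m@((uw , _) , (wv , _)) with wu , w→v ← ∇⁻ E′ m =
      ∇⁺ E uw wv [ lower (inj₁ (Arc⇒≢ D wv)) wu ] [ lower (inj₁ (Arc⇒≢ D wv)) w→v ]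
    Δ-down : ∀ {w} → Δ⟨_⟩ D E′ u v w → Δ⟨_⟩ D E u v w
    Δ-down m@((uw , _) , (wv , _)) with u→w , vw ← Δ⁻ E′ m =
      Δ⁺ E uw wv [ lower (inj₂ (Arc⇒≢ D uw ∘ sym)) u→w ] [ lower (inj₂ (Arc⇒≢ D uw ∘ sym)) vw ]

-- Minimal and maximal elements of congruence classes.

module ExtremalElements
  {n : ℕ} {ℓ : Level} {D : DAG n} (filled : Filled D) {℧ Ω : Subset n}
  {_∼_ : Rel (AcyclicReorientation D) ℓ} (coherent : IsCoherentCongruence D ℧ Ω _∼_)
  (E : AcyclicReorientation D) where
  open AcyclicReorientation
  open DAG D
  open Order (AR D)
  open IsCoherentCongruence coherent using (isCongruence)
  open IsCongruence isCongruence
  private module ∼ = IsEquivalence isEquivalence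

  private
    -- Join both sides of `x ∼ z` with `y`.
    convex : ∀ {x y z} → x ⊑ y → y ⊑ z → x ∼ z → y ∼ z
    convex {x} {y} {z} x⊑y y⊑z x∼z = ∨-compatible (∼.refl {y}) x∼z
      (id , x⊑y , λ _ y⊑w _ → y⊑w) (y⊑z , id , λ _ _ z⊑w → z⊑w)

    T : Rel (Fin n) 0ℓ
    T = TransitiveReduction (Arcᴱ E)

  minimal⇒fits : MinimalInClass _∼_ E → ∀ u v → Arc u v → T v u → Fits D ℧ Ω E u v
  minimal⇒fits minimal u v uv t = CoverRope.≁⇒fits filled cover coherent λ F∼E →
    unreversed (proj₂ (minimal _ F∼E lower⊑upper) (arc , new))
    where
    cover = cover-below E uv t
    open Cover cover

  -- If `y` differed from `E`, it would unreverse some reduction arc of `E`, so it would lie below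
  -- the corresponding lower cover. Convexity makes that cover congruent to `E`, against `fits⇒≁`.
  fits⇒minimal : (∀ u v → Arc u v → T v u → Fits D ℧ Ω E u v) → MinimalInClass _∼_ E
  fits⇒minimal fits y y∼E y⊑E = y⊑E , λ (ab , ba) → ab , reduction-determines E y included ba
    where
    included : T ⇒ Arcᴱ y
    included {c} {d} t with proj₂ (sameUnderlying E) (fwd (proj₁ t))
    ... | fwd cd = [ id , (λ dc → contradiction (proj₂ (y⊑E (cd , dc)) ∷ [ proj₁ t ]) (irrefl⁺ᴱ E)) ]′
                     (reorient y cd)
    ... | bwd dc with reorient y dc
    ...   | inj₂ cd  = cd
    ...   | inj₁ dc′ = contradiction
      (convex (below y y⊑E λ (_ , cd) → irrefl⁺ᴱ y (dc′ ∷ [ cd ])) lower⊑upper y∼E)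
      (CoverRope.fits⇒≁ filled cover coherent (fits d c dc t))
      where
      cover = cover-below E dc t
      open Cover cover

  -- The rope is read off the upper end of a cover, and `E` is now the lower end; `fits-lower`
  -- bridges the two.
  maximal⇒fits : MaximalInClass _∼_ E → ∀ u v → Arc u v → T u v → Fits D ℧ Ω E u v
  maximal⇒fits maximal u v uv t =
    CoverRope.fits-lower filled cover (CoverRope.≁⇒fits filled cover coherent λ E∼F →
      unreversed (proj₂ (maximal _ (∼.sym E∼F) lower⊑upper) (arc , new)))
    where
    cover = cover-above E uv t
    open Cover cover

  fits⇒maximal : (∀ u v → Arc u v → T u v → Fits D ℧ Ω E u v) → MaximalInClass _∼_ E
  fits⇒maximal fits y y∼E E⊑y = E⊑y , λ (ab , ba) →
    -- An arc unreversed in `E` stays so in `y`, once `y` contains the reduction of `E`.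
    [ (λ ab′ → contradiction (reduction-determines E y included ab′ ∷ [ ba ]) (irrefl⁺ᴱ y)) , (ab ,_) ]′
      (reorient E ab)
    where
    included : T ⇒ Arcᴱ y
    included {c} {d} t with proj₂ (sameUnderlying E) (fwd (proj₁ t))
    ... | bwd dc = proj₂ (E⊑y (dc , proj₁ t))
    ... | fwd cd with reorient y cd
    ...   | inj₁ cd′ = cd′
    ...   | inj₂ dc  = contradiction
      (∼.trans (∼.sym y∼E) (∼.sym (convex lower⊑upper (above y E⊑y (cd , dc)) (∼.sym y∼E))))
      (CoverRope.fits⇒≁ filled cover coherent (CoverRope.fits-upper filled cover (fits c d cd t)))
      where
      cover = cover-above E cd t
      open Cover cover

proposition48 :
    ∀ {n : ℕ} {ℓ : Level} (D : DAG n) → Skeletal D →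
    ∀ (℧ Ω : Subset n) (_∼_ : Rel (AcyclicReorientation D) ℓ) →
    IsCoherentCongruence D ℧ Ω _∼_ →
    ∀ (E : AcyclicReorientation D) →
    let open DAG D using (Arc)
        open AcyclicReorientation E using (Arcᴱ)
        open Order (AR D)
    in
    ( (MinimalInClass _∼_ E ⇔
        (∀ (u v : Fin n) → Arc u v → TransitiveReduction Arcᴱ v u → Fits D ℧ Ω E u v))
    × ((∀ (u v : Fin n) → Arc u v → TransitiveReduction Arcᴱ v u → Fits D ℧ Ω E u v) ⇔
        (∀ (u v : Fin n) → Arc u v → Arcᴱ v u → Fits D ℧ Ω E u v))
    ) ×
    ( (MaximalInClass _∼_ E ⇔
        (∀ (u v : Fin n) → Arc u v → TransitiveReduction Arcᴱ u v → Fits D ℧ Ω E u v))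
    × ((∀ (u v : Fin n) → Arc u v → TransitiveReduction Arcᴱ u v → Fits D ℧ Ω E u v) ⇔
        (∀ (u v : Fin n) → Arc u v → Arcᴱ u v → Fits D ℧ Ω E u v))
    )
proposition48 D skeletal ℧ Ω _∼_ coherent E =
  ( mk⇔ minimal⇒fits fits⇒minimal
  , mk⇔ reversed-fits (λ fits u v uv t → fits u v uv (proj₁ t)) ) ,
  ( mk⇔ maximal⇒fits fits⇒maximal
  , mk⇔ unreversed-fits (λ fits u v uv t → fits u v uv (proj₁ t)) )
  where
  open ExtremalElements (proj₂ skeletal) coherent E
  open FitsOnReduction skeletal ℧ Ω E
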